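{- Let $k\ge1$, $d\ge0$, $i\ge1$, let $\left(S^{(0)}_{1,\ldots,i},S^{(1)}_{1,\ldots,i},S^{(2)}_{1,\ldots,i},S^{(3)}_{1,\ldots,i}\right)$ be a generalized rewriting rule with $S^{(m)}_j\subseteq\{0,1,2,3\}^d$, and let $h\in[k]$. Let $K\subseteq\{0,1,2,3\}^k$ be a USO and let $L:K\to[i]$ be a labelling function. Then $T_h(K,L)$ is a USO of strings in $\{0,1,2,3\}^{k+d-1}$.
   Context: Hypercubes and USOs. $[k]=\{1,\ldots,k\}$. $Q_k$ is the $k$-dimensional hypercube graph with vertex set $\{0,1\}^k$; $v\oplus i$ denotes the neighbor of $v$ differing from $v$ exactly in coordinate $i$. An orientation $O$ of $Q_k$ directs every edge; it is identified with the function $O:\{0,1\}^k\to\{0,1\}^k$ where $O(v)_i=1$ if the edge $\{v,v\oplus i\}$ is directed upwards (from its endpoint with $i$-th coordinate $0$ to its endpoint with $i$-th coordinate $1$) and $O(v)_i=0$ if it is directed downwards (so $O(v)_i=O(v\oplus i)_i$). A face is the subgraph induced by all vertices that agree with a fixed string $f\in\{0,1,*\}^k$ on the non-$*$ positions. $O$ is a Unique Sink Orientation (USO) if every face contains exactly one vertex with no outgoing edges inside that face. String encoding. An orientation $O$ of $Q_k$ is encoded as the set of $2^k$ strings $\{p(v): v\in\{0,1\}^k\}\subseteq\{0,1,2,3\}^k$ with $p(v)_i=2v_i+O(v)_i$. A set $K\subseteq\{0,1,2,3\}^k$ is said to be (or define) a $k$-dimensional USO if it is the encoding of some USO of $Q_k$.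 The only $0$-dimensional USO is $\{\varepsilon\}$, with $\varepsilon$ the empty string. Generalized rewriting rule. For $i\ge1$, a generalized rewriting rule consists of sets $S^{(m)}_j\subseteq\{0,1,2,3\}^d$ ($m\in\{0,1,2,3\}$, $j\in[i]$) such that for all $j,j'\in[i]$: (i) $S^{(0)}_j\cap S^{(2)}_{j'}=\emptyset$ and $S^{(0)}_j\cup S^{(2)}_{j'}$ defines a $d$-dimensional USO; (ii) $S^{(1)}_j\cap S^{(3)}_{j'}=\emptyset$ and $S^{(1)}_j\cup S^{(3)}_{j'}$ defines a $d$-dimensional USO. For $K\subseteq\{0,1,2,3\}^k$, a labelling $L:K\to[i]$ and $h\in[k]$, applying the rule to $K$ on dimension $h$ gives $$T_h(K,L)=\bigcup_{v\in K}\left\{v_1\cdots v_{h-1}\,t_1\cdots t_d\,v_{h+1}\cdots v_k \;\middle|\; t\in S^{(v_h)}_{L(v)}\right\}\subseteq\{0,1,2,3\}^{k+d-1}.$$ -}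

module Defs where

open import Data.Nat.Base using (ℕ; zero; suc; _+_; _∸_)
open import Data.Nat.Properties using (+-comm)
open import Data.Fin.Base using (Fin; zero; suc; combine; opposite)
open import Data.Fin.Patterns using (0F; 1F; 2F; 3F)
open import Data.Maybe.Base using (Maybe; just; nothing)
open import Data.Product using (Σ; ∃; ∃!; _×_)
open import Data.Sum.Base using (_⊎_)
open import Data.Vec.Base using (Vec; []; _∷_; _++_; cast; lookup; updateAt; zipWith)
open import Level using (Level; _⊔_; 0ℓ) renaming (suc to lsuc)
open import Relation.Binary.PropositionalEquality.Core using (_≡_)
open import Relation.Nullary.Negation.Core using (¬_)
open import Relation.Unary using (Pred; _∈_; _∩_; _∪_; _≐_; Empty)

private
  variable
    a ℓ   : Level
    A     : Set a
    k d i : ℕ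

Vertex : ℕ → Set
Vertex k = Vec (Fin 2) k

infixl 6 _⊕_

_⊕_ : Vertex k → Fin k → Vertex k
v ⊕ i = updateAt v i opposite

-- Bit i of `dir v` is 1 when the edge {v, v ⊕ i} points from its endpoint with
-- i-th coordinate 0 to the one with i-th coordinate 1; it is a property of the
-- edge, not of v, whence `consistent`.
record Orientation (k : ℕ) : Set where
  field
    dir        : Vertex k → Vertex k
    consistent : ∀ v i → lookup (dir v) i ≡ lookup (dir (v ⊕ i)) i

open Orientation public

Outgoing : Orientation k → Vertex k → Fin k → Set
Outgoing O v i = (lookup v i ≡ 0F × lookup (dir O v) i ≡ 1F)
               ⊎ (lookup v i ≡ 1F × lookup (dir O v) i ≡ 0F)

-- Strings over {0,1,*}, with `nothing` for *.
Face : ℕ → Set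
Face k = Vec (Maybe (Fin 2)) k

⟦_⟧ : Face k → Pred (Vertex k) 0ℓ
⟦ f ⟧ v = ∀ i b → lookup f i ≡ just b → lookup v i ≡ b

-- The edge {v, v ⊕ i} lies inside the (induced) face when both endpoints do.
IsSinkOf : Orientation k → Face k → Pred (Vertex k) 0ℓ
IsSinkOf O f v = v ∈ ⟦ f ⟧ × (∀ i → v ⊕ i ∈ ⟦ f ⟧ → ¬ Outgoing O v i)

IsUSO : Orientation k → Set
IsUSO O = ∀ f → ∃! _≡_ (IsSinkOf O f)

Str : ℕ → Set
Str k = Vec (Fin 4) k

-- On bits, `combine x y` is 2x + y.
encode : Orientation k → Vertex k → Str k
encode O v = zipWith combine v (dir O v)

Encoding : Orientation k → Pred (Str k) 0ℓ
Encoding O s = ∃ λ v → s ≡ encode O v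

DefinesUSO : Pred (Str k) ℓ → Set ℓ
DefinesUSO {k} K = Σ (Orientation k) λ O → IsUSO O × K ≐ Encoding O

record GeneralizedRule (d i : ℕ) (ℓ : Level) : Set (lsuc ℓ) where
  field
    S          : Fin 4 → Fin i → Pred (Str d) ℓ
    disjoint₀₂ : ∀ j j′ → Empty (S 0F j ∩ S 2F j′)
    uso₀₂      : ∀ j j′ → DefinesUSO (S 0F j ∪ S 2F j′)
    disjoint₁₃ : ∀ j j′ → Empty (S 1F j ∩ S 3F j′)
    uso₁₃      : ∀ j j′ → DefinesUSO (S 1F j ∪ S 3F j′)

open GeneralizedRule public

-- The membership proof is irrelevant, so a label depends only on the string.
Labelling : Pred (Str k) ℓ → ℕ → Set ℓ
Labelling K i = ∀ v → .(v ∈ K) → Fin i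

-- v₁ ⋯ vₕ₋₁ t₁ ⋯ t_d vₕ₊₁ ⋯ vₖ
splice : Vec A k → Fin k → Vec A d → Vec A (k + d ∸ 1)
splice {k = suc k} {d = d} (_ ∷ v)  zero    t = cast (+-comm d k) (t ++ v)
splice (x ∷ v@(_ ∷ _))              (suc h) t = x ∷ splice v h t

T : GeneralizedRule d i a → (h : Fin k) (K : Pred (Str k) ℓ) →
    Labelling K i → Pred (Str (k + d ∸ 1)) (a ⊔ ℓ)
T R h K L s = ∃ λ v → Σ (v ∈ K) λ v∈K →
  ∃ λ t → t ∈ S R (lookup v h) (L v v∈K) × s ≡ splice v h t

{-# OPTIONS --safe #-}
-- Filling the stars of a face f with the corresponding bits of O(v) fixes v
-- exactly when v is a sink of f, so a USO is a map on vertices for which every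
-- face has a unique such fixed point.  Consistency is then automatic: apply this
-- to the edges, using that a map on bits with a unique fixed point is constant.
--
-- Above a vertex u of the remaining k − 1 coordinates, let β be the direction
-- of the h-edge.  The rule replaces that edge by a d-dimensional USO, each
-- vertex y of which belongs to one end c of the edge, and there the remaining
-- coordinates are oriented as at that end.  Mixing labels shows that the end
-- to which the sink of a d-face belongs depends on β only.  On the other hand
-- the sinks u₀, u₁ of the two h-facets of a face of K have the same β, again
-- because x ↦ β(uₓ) has a unique fixed point, given by the sink of the face.
-- Hence both select the same end g, and the unique sink of the product face
-- lies above u_g.
module Submission where

open import Data.Empty using (⊥-elim)
open import Data.Fin.Base using (Fin; zero; suc; combine; opposite)
open import Data.Fin.Patterns using (0F; 1F)
open import Data.Fin.Properties using (_≟_; combine-injective)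
open import Data.Maybe.Base using (just; nothing; fromMaybe)
open import Data.Nat.Base using (ℕ; suc; _+_; _≤_)
open import Data.Nat.Properties using (+-comm)
open import Data.Product using (Σ; ∃; ∃₂; ∃!; _×_; _,_; proj₁; proj₂)
open import Data.Sum.Base using (inj₁; inj₂)
open import Data.Vec.Base
open import Data.Vec.Properties
open import Function.Base using (_∘_; case_of_)
open import Level using (Level)
open import Relation.Binary.PropositionalEquality
open import Relation.Nullary using (¬_; yes; no; contradiction)
open import Relation.Unary using (Pred; _∈_; _∪_)
open import Defs

private
  variable
    a ℓ     : Level
    A B C   : Set a
    k d i n : ℕ

-- Inserting, deleting and splicing coordinates.

lookup-injective : {xs ys : Vec A n} → (∀ j → lookup xs j ≡ lookup ys j) → xs ≡ ys
lookup-injective {xs = xs} {ys} eq = begin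
  xs                    ≡⟨ tabulate∘lookup xs ⟨
  tabulate (lookup xs)  ≡⟨ tabulate-cong eq ⟩
  tabulate (lookup ys)  ≡⟨ tabulate∘lookup ys ⟩
  ys                    ∎
  where open ≡-Reasoning

zipWith-insertAt : ∀ (g : A → B → C) (w : Vec A (suc n)) f h m →
  zipWith g w (insertAt f h m) ≡ insertAt (zipWith g (removeAt w h) f) h (g (lookup w h) m)
zipWith-insertAt g (_ ∷ _)         _       zero    m = refl
zipWith-insertAt g (x ∷ w@(_ ∷ _)) (y ∷ f) (suc h) m = cong (g x y ∷_) (zipWith-insertAt g w f h m)

removeAt-zipWith : ∀ (g : A → B → C) (v : Vec A (suc n)) w h →
  removeAt (zipWith g v w) h ≡ zipWith g (removeAt v h) (removeAt w h)
removeAt-zipWith g (_ ∷ _)         (_ ∷ _)         zero    = refl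
removeAt-zipWith g (x ∷ v@(_ ∷ _)) (y ∷ w@(_ ∷ _)) (suc h) = cong (g x y ∷_) (removeAt-zipWith g v w h)

insertAt-injective : ∀ {u v : Vec A n} h {x y} → insertAt u h x ≡ insertAt v h y → u ≡ v × x ≡ y
insertAt-injective {u = u} {v} h {x} {y} eq =
  trans (sym (removeAt-insertAt u h x)) (trans (cong (λ w → removeAt w h) eq) (removeAt-insertAt v h y)) ,
  trans (sym (insertAt-lookup u h x)) (trans (cong (λ w → lookup w h) eq) (insertAt-lookup v h y))

insertAt-⊕ : ∀ (u : Vertex k) h x → insertAt u h x ⊕ h ≡ insertAt u h (opposite x)
insertAt-⊕ u       zero    x = refl
insertAt-⊕ (y ∷ u) (suc h) x = cong (y ∷_) (insertAt-⊕ u h x)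

zipWith-cast : ∀ {m n} (g : A → B → C) (eq : m ≡ n) xs ys →
  zipWith g (cast eq xs) (cast eq ys) ≡ cast eq (zipWith g xs ys)
zipWith-cast g refl xs ys = begin
  zipWith g (cast refl xs) (cast refl ys)  ≡⟨ cong₂ (zipWith g) (cast-is-id refl xs) (cast-is-id refl ys) ⟩
  zipWith g xs ys                          ≡⟨ cast-is-id refl _ ⟨
  cast refl (zipWith g xs ys)              ∎
  where open ≡-Reasoning

cast-injective : ∀ {m n} (eq : m ≡ n) {xs ys : Vec A m} → cast eq xs ≡ cast eq ys → xs ≡ ys
cast-injective refl {xs} {ys} p = trans (sym (cast-is-id refl xs)) (trans p (cast-is-id refl ys))

-- `splice` after the discarded h-th entry has been removed. The length `suc k + d ∸ 1` reduces to
-- `k + d`, so the two agree without a further cast.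
merge : Fin (suc k) → Vec A k → Vec A d → Vec A (k + d)
merge {k = k} {d = d} zero    u       t = cast (+-comm d k) (t ++ u)
merge                 (suc h) (x ∷ u) t = x ∷ merge h u t

splice-merge : ∀ (v : Vec A (suc k)) h (t : Vec A d) → splice v h t ≡ merge h (removeAt v h) t
splice-merge (_ ∷ _)         zero    t = refl
splice-merge (x ∷ v@(_ ∷ _)) (suc h) t = cong (x ∷_) (splice-merge v h t)

unmerge : ∀ (h : Fin (suc k)) (z : Vec A (k + d)) → ∃₂ λ u t → z ≡ merge h u t
unmerge {k = k} {d = d} zero z with t , u , eq ← splitAt d (cast (+-comm k d) z) =
  u , t , sym (cast-sym (+-comm k d) eq)
unmerge {k = suc k} (suc h) (x ∷ z) with u , t , refl ← unmerge h z = x ∷ u , t , refl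

merge-injective : ∀ h {u v : Vec A k} {s t : Vec A d} → merge h u s ≡ merge h v t → u ≡ v × s ≡ t
merge-injective {k = k} {d = d} zero {s = s} {t} eq
  with s≡t , u≡v ← ++-injective s t (cast-injective (+-comm d k) eq) = u≡v , s≡t
merge-injective (suc h) {_ ∷ _} {_ ∷ _} eq
  with refl , tails ← ∷-injective eq
  with refl , s≡t ← merge-injective h tails = refl , s≡t

zipWith-merge : ∀ (g : A → B → C) h (u : Vec A k) v (s : Vec A d) t →
  zipWith g (merge h u s) (merge h v t) ≡ merge h (zipWith g u v) (zipWith g s t)
zipWith-merge {k = k} {d = d} g zero u v s t =
  trans (zipWith-cast g (+-comm d k) (s ++ u) (t ++ v)) (cong (cast _) (zipWith-++ g s u t v))
zipWith-merge g (suc h) (x ∷ u) (y ∷ v) s t = cong (g x y ∷_) (zipWith-merge g h u v s t)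

splice-zipWith : ∀ (g : A → A → B) (u : Vec A k) h x w (y z : Vec A d) →
  splice (zipWith g (insertAt u h x) w) h (zipWith g y z) ≡
  zipWith g (merge h u y) (merge h (removeAt w h) z)
splice-zipWith g u h x w y z = begin
  splice (zipWith g (insertAt u h x) w) h (zipWith g y z)
    ≡⟨ splice-merge (zipWith g (insertAt u h x) w) h (zipWith g y z) ⟩
  merge h (removeAt (zipWith g (insertAt u h x) w) h) (zipWith g y z)
    ≡⟨ cong (λ v → merge h v (zipWith g y z)) (removeAt-zipWith g (insertAt u h x) w h) ⟩
  merge h (zipWith g (removeAt (insertAt u h x) h) (removeAt w h)) (zipWith g y z)
    ≡⟨ cong (λ v → merge h (zipWith g v (removeAt w h)) (zipWith g y z)) (removeAt-insertAt u h x) ⟩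
  merge h (zipWith g u (removeAt w h)) (zipWith g y z)
    ≡⟨ zipWith-merge g h u (removeAt w h) y z ⟨
  zipWith g (merge h u y) (merge h (removeAt w h) z) ∎
  where open ≡-Reasoning

-- Sinks of faces as fixed points.

IsFixed : (Vertex k → Vertex k) → Face k → Pred (Vertex k) _
IsFixed σ f v = v ≡ zipWith fromMaybe (σ v) f

UniqueFixed : (Vertex k → Vertex k) → Set
UniqueFixed σ = ∀ f → ∃! _≡_ (IsFixed σ f)

opposite-≢ : ∀ (x : Fin 2) → ¬ opposite x ≡ x
opposite-≢ 0F ()
opposite-≢ 1F ()

module _ (O : Orientation k) {f : Face k} {v : Vertex k} where

  -- An edge points to the endpoint whose bit equals its direction, so it is not outgoing at `v`
  -- exactly when the two bits agree. At a star the edge stays in the face and the sink condition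
  -- applies; elsewhere `f` prescribes the bit.
  sink⇒fixed : IsSinkOf O f v → IsFixed (dir O) f v
  sink⇒fixed (v∈f , noOut) = lookup-injective λ j →
    trans (pointwise j) (sym (lookup-zipWith fromMaybe j (dir O v) f))
    where
    ⊕-stays : ∀ j → lookup f j ≡ nothing → v ⊕ j ∈ ⟦ f ⟧
    ⊕-stays j fⱼ j′ b eq with j′ ≟ j
    ... | yes refl = case trans (sym fⱼ) eq of λ ()
    ... | no j′≢j  = trans (lookup∘updateAt′ j′ j j′≢j v) (v∈f j′ b eq)

    pointwise : ∀ j → lookup v j ≡ fromMaybe (lookup (dir O v) j) (lookup f j)
    pointwise j with lookup f j in eq
    ... | just b = v∈f j b eq
    ... | nothing with lookup v j in vⱼ | lookup (dir O v) j in dⱼ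
    ...   | 0F | 0F = refl
    ...   | 1F | 1F = refl
    ...   | 0F | 1F = contradiction (inj₁ (vⱼ , dⱼ)) (noOut j (⊕-stays j eq))
    ...   | 1F | 0F = contradiction (inj₂ (vⱼ , dⱼ)) (noOut j (⊕-stays j eq))

  fixed⇒sink : IsFixed (dir O) f v → IsSinkOf O f v
  fixed⇒sink fixed = v∈f , noOut
    where
    pointwise : ∀ j → lookup v j ≡ fromMaybe (lookup (dir O v) j) (lookup f j)
    pointwise j = trans (cong (λ w → lookup w j) fixed) (lookup-zipWith fromMaybe j (dir O v) f)

    v∈f : v ∈ ⟦ f ⟧
    v∈f j b eq = trans (pointwise j) (cong (fromMaybe (lookup (dir O v) j)) eq)

    noOut : ∀ j → v ⊕ j ∈ ⟦ f ⟧ → ¬ Outgoing O v j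
    noOut j v⊕j∈f out with lookup f j in eq | pointwise j
    ... | just b | vⱼ≡b = opposite-≢ (lookup v j)
      (trans (sym (lookup∘updateAt j v)) (trans (v⊕j∈f j b eq) (sym vⱼ≡b)))
    ... | nothing | vⱼ≡dⱼ with out
    ...   | inj₁ (vⱼ≡0 , dⱼ≡1) = case trans (sym vⱼ≡0) (trans vⱼ≡dⱼ dⱼ≡1) of λ ()
    ...   | inj₂ (vⱼ≡1 , dⱼ≡0) = case trans (sym vⱼ≡1) (trans vⱼ≡dⱼ dⱼ≡0) of λ ()

uso⇒uniqueFixed : (O : Orientation k) → IsUSO O → UniqueFixed (dir O)
uso⇒uniqueFixed O uso f with v , sink , unique ← uso f =
  v , sink⇒fixed O sink , unique ∘ fixed⇒sink O

-- Of the four maps on bits only the identity and negation are not constant; the former has two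
-- fixed points, the latter none.
unique-fixpoint⇒constant : (φ : Fin 2 → Fin 2) → ∃! _≡_ (λ x → x ≡ φ x) → ∀ x y → φ x ≡ φ y
unique-fixpoint⇒constant φ (x₀ , fix , unique) = λ
  { 0F 0F → refl
  ; 0F 1F → agree (φ 0F) (φ 1F) refl refl
  ; 1F 0F → sym (agree (φ 0F) (φ 1F) refl refl)
  ; 1F 1F → refl
  }
  where
  absurd : ∀ x → x ≡ φ x → φ 0F ≡ 1F → φ 1F ≡ 0F → 1F ≡ 0F
  absurd 0F eq φ0 φ1 = sym (trans eq φ0)
  absurd 1F eq φ0 φ1 = trans eq φ1

  agree : ∀ p q → φ 0F ≡ p → φ 1F ≡ q → p ≡ q
  agree 0F 0F _  _  = refl
  agree 1F 1F _  _  = refl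
  agree 0F 1F φ0 φ1 = trans (sym (unique (sym φ0))) (unique (sym φ1))
  agree 1F 0F φ0 φ1 = absurd x₀ fix φ0 φ1

-- The face is the edge through `v` along `j`, so only the bit at `j` is taken from `w`.
zipWith-edge : ∀ (w v : Vertex k) j →
  zipWith fromMaybe w (map just v [ j ]≔ nothing) ≡ v [ j ]≔ lookup w j
zipWith-edge (x ∷ w) (y ∷ v) zero    = cong (x ∷_) (zipWith-just w v)
  where
  zipWith-just : ∀ {k} (w v : Vertex k) → zipWith fromMaybe w (map just v) ≡ v
  zipWith-just []      []      = refl
  zipWith-just (_ ∷ w) (y ∷ v) = cong (y ∷_) (zipWith-just w v)
zipWith-edge (x ∷ w) (y ∷ v) (suc j) = cong (y ∷_) (zipWith-edge w v j)

uniqueFixed⇒consistent : (σ : Vertex k → Vertex k) → UniqueFixed σ →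
  ∀ v j → lookup (σ v) j ≡ lookup (σ (v ⊕ j)) j
uniqueFixed⇒consistent σ uf v j = begin
  lookup (σ v) j             ≡⟨ cong (λ w → lookup (σ w) j) ([]≔-lookup v j) ⟨
  φ (lookup v j)             ≡⟨ unique-fixpoint⇒constant φ uniqueφ _ _ ⟩
  φ (opposite (lookup v j))  ≡⟨ cong (λ w → lookup (σ w) j) (updateAt-cong-local j v refl) ⟩
  lookup (σ (v ⊕ j)) j       ∎
  where
  open ≡-Reasoning

  φ : Fin 2 → Fin 2
  φ x = lookup (σ (v [ j ]≔ x)) j

  uniqueφ : ∃! _≡_ (λ x → x ≡ φ x)
  -- A fixed vertex of the edge is determined by its bit at `j`, which is a fixed point of `φ`;
  -- conversely every fixed point of `φ` gives a fixed vertex.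
  uniqueφ with w , fixed , unique ← uf (map just v [ j ]≔ nothing) =
    lookup (σ w) j ,
    cong (λ w → lookup (σ w) j) (trans fixed (zipWith-edge (σ w) v j)) ,
    λ {x} x≡φx → trans
      (cong (λ w → lookup (σ w) j)
        (unique (trans (cong (v [ j ]≔_) x≡φx) (sym (zipWith-edge _ v j)))))
      (sym x≡φx)

orientation : (σ : Vertex k → Vertex k) → UniqueFixed σ → Orientation k
orientation σ uf = record { dir = σ ; consistent = uniqueFixed⇒consistent σ uf }

orientation-uso : ∀ (σ : Vertex k → Vertex k) uf → IsUSO (orientation σ uf)
orientation-uso σ uf f with v , fixed , unique ← uf f =
  v , fixed⇒sink (orientation σ uf) fixed , unique ∘ sink⇒fixed (orientation σ uf)

-- The two facets across a coordinate.

module Facets (σ : Vertex (suc k) → Vertex (suc k)) (uf : UniqueFixed σ) (h : Fin (suc k)) where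

  facet : Fin 2 → Vertex k → Vertex k
  facet x u = removeAt (σ (insertAt u h x)) h

  -- The direction of the h-edge above `u`, read at its lower end; by `axis-const` either end would
  -- do.
  axis : Vertex k → Fin 2
  axis u = lookup (σ (insertAt u h 0F)) h

  axis-const : ∀ u x → lookup (σ (insertAt u h x)) h ≡ axis u
  axis-const u 0F = refl
  axis-const u 1F = sym (trans (uniqueFixed⇒consistent σ uf (insertAt u h 0F) h)
                               (cong (λ w → lookup (σ w) h) (insertAt-⊕ u h 0F)))

  -- Two kinds of faces are treated at once: `m = just x` stays within a facet, while `m = nothing`
  -- spans both, and there `x` must be the end to which the h-edge points.
  fixed-insertAt : ∀ {f u m x} → IsFixed (facet x) f u → x ≡ fromMaybe (axis u) m →
    IsFixed σ (insertAt f h m) (insertAt u h x)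
  fixed-insertAt {f} {u} {m} {x} p q = trans
    (cong₂ (λ u x → insertAt u h x) p (trans q (cong (λ b → fromMaybe b m) (sym (axis-const u x)))))
    (sym (zipWith-insertAt fromMaybe _ f h m))

  insertAt-fixed : ∀ {f u m x} → IsFixed σ (insertAt f h m) (insertAt u h x) →
    IsFixed (facet x) f u × x ≡ fromMaybe (axis u) m
  insertAt-fixed {f} {u} {m} {x} fixed
    with p , q ← insertAt-injective h (trans fixed (zipWith-insertAt fromMaybe _ f h m)) =
    p , trans q (cong (λ b → fromMaybe b m) (axis-const u x))

  fixed-removeAt : ∀ {f m w} → IsFixed σ (insertAt f h m) w →
    IsFixed (facet (lookup w h)) f (removeAt w h) × lookup w h ≡ fromMaybe (axis (removeAt w h)) m
  fixed-removeAt {f} {m} {w} fixed =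
    insertAt-fixed (subst (IsFixed σ (insertAt f h m)) (sym (insertAt-removeAt w h)) fixed)

  facet-uniqueFixed : ∀ x → UniqueFixed (facet x)
  facet-uniqueFixed x f with w , fixed , unique ← uf (insertAt f h (just x))
    with p , q ← fixed-removeAt fixed =
    removeAt w h ,
    subst (λ x → IsFixed (facet x) f (removeAt w h)) q p ,
    λ {u} fixed′ → trans (cong (λ w → removeAt w h) (unique (fixed-insertAt fixed′ refl)))
                         (removeAt-insertAt u h x)

  axis-agrees : ∀ f {u u′ x x′} → IsFixed (facet x) f u → IsFixed (facet x′) f u′ →
    axis u ≡ axis u′
  axis-agrees f {u} {u′} {x} {x′} p p′ = begin
    axis u   ≡⟨ cong axis (proj₂ (proj₂ (facet-uniqueFixed x f)) p) ⟨
    φ x      ≡⟨ unique-fixpoint⇒constant φ uniqueφ x x′ ⟩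
    φ x′     ≡⟨ cong axis (proj₂ (proj₂ (facet-uniqueFixed x′ f)) p′) ⟩
    axis u′  ∎
    where
    open ≡-Reasoning

    φ : Fin 2 → Fin 2
    φ x = axis (proj₁ (facet-uniqueFixed x f))

    uniqueφ : ∃! _≡_ (λ x → x ≡ φ x)
    -- The sink of the face with a star at `h` is a facet sink of `f`, on the end to which its own
    -- h-edge points. Thus fixed points of `φ` correspond to sinks of this face.
    uniqueφ with w , fixed , unique ← uf (insertAt f h nothing)
      with p , q ← fixed-removeAt fixed =
      lookup w h ,
      trans q (cong axis (sym (proj₂ (proj₂ (facet-uniqueFixed (lookup w h) f)) p))) ,
      λ {x} x≡φx → trans
        (cong (λ w → lookup w h)
          (unique (fixed-insertAt (proj₁ (proj₂ (facet-uniqueFixed x f))) x≡φx)))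
        (insertAt-lookup _ h x)

-- Products with mutually dependent factors.

module Product (h : Fin (suc k)) (base : Fin 2 → Vertex k → Vertex k)
               (fibre : Vertex k → Vertex d → Vertex d) (end : Vertex k → Vertex d → Fin 2) where

  -- The factors depend on each other: `fibre` varies with `u`, and `base` varies with `y` through
  -- `end u y`. The hypothesis `ends-agree` below breaks this circle.
  σ : Vertex (k + d) → Vertex (k + d)
  σ z = let u , y , _ = unmerge h z in merge h (base (end u y) u) (fibre u y)

  σ-merge : ∀ u y → σ (merge h u y) ≡ merge h (base (end u y) u) (fibre u y)
  σ-merge u y =
    let u′ , y′ , eq = unmerge h (merge h u y)
        u≡u′ , y≡y′  = merge-injective h eq
    in sym (cong₂ (λ u y → merge h (base (end u y) u) (fibre u y)) u≡u′ y≡y′)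

  zipWith-σ : ∀ u y f e → zipWith fromMaybe (σ (merge h u y)) (merge h f e) ≡
    merge h (zipWith fromMaybe (base (end u y) u) f) (zipWith fromMaybe (fibre u y) e)
  zipWith-σ u y f e = trans (cong (λ w → zipWith fromMaybe w (merge h f e)) (σ-merge u y))
                            (zipWith-merge fromMaybe h _ f _ e)

  module _ (base-uniqueFixed : ∀ x → UniqueFixed (base x))
           (fibre-uniqueFixed : ∀ u → UniqueFixed (fibre u))
           (ends-agree : ∀ {f e x x′ u u′ y y′} → IsFixed (base x) f u → IsFixed (base x′) f u′ →
              IsFixed (fibre u) e y → IsFixed (fibre u′) e y′ → end u y ≡ end u′ y′) where

    merge-uniqueFixed : ∀ f e → ∃! _≡_ (IsFixed σ (merge h f e))
    merge-uniqueFixed f e = merge h (u₊ g) (y₊ (u₊ g)) , fixed , unique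
      where
      u₊ : Fin 2 → Vertex k
      u₊ x = proj₁ (base-uniqueFixed x f)

      u₊-fixed : ∀ x → IsFixed (base x) f (u₊ x)
      u₊-fixed x = proj₁ (proj₂ (base-uniqueFixed x f))

      y₊ : Vertex k → Vertex d
      y₊ u = proj₁ (fibre-uniqueFixed u e)

      y₊-fixed : ∀ u → IsFixed (fibre u) e (y₊ u)
      y₊-fixed u = proj₁ (proj₂ (fibre-uniqueFixed u e))

      g : Fin 2
      -- Starting from `0F` is arbitrary: by `ends-agree` all such pairs of sinks yield the same
      -- end.
      g = end (u₊ 0F) (y₊ (u₊ 0F))

      end≡g : ∀ {x u y} → IsFixed (base x) f u → IsFixed (fibre u) e y → end u y ≡ g
      end≡g p q = ends-agree p (u₊-fixed 0F) q (y₊-fixed (u₊ 0F))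

      fixed : IsFixed σ (merge h f e) (merge h (u₊ g) (y₊ (u₊ g)))
      -- `u₊ g` is fixed for `base g`, whereas `σ` uses `base` at the end of the candidate itself;
      -- `end≡g` identifies the two.
      fixed = trans
        (cong₂ (merge h)
          (subst (λ x → IsFixed (base x) f (u₊ g))
                 (sym (end≡g (u₊-fixed g) (y₊-fixed (u₊ g)))) (u₊-fixed g))
          (y₊-fixed (u₊ g)))
        (sym (zipWith-σ (u₊ g) (y₊ (u₊ g)) f e))

      unique-merge : ∀ u y → IsFixed σ (merge h f e) (merge h u y) →
        merge h (u₊ g) (y₊ (u₊ g)) ≡ merge h u y
      unique-merge u y fixed′ =
        let p , q = merge-injective h (trans fixed′ (zipWith-σ u y f e))
            -- Only once the end is known to be `g` do `u` and `u₊ g` belong to the same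
            -- orientation.
            u₊≡u  = proj₂ (proj₂ (base-uniqueFixed g f))
                      (subst (λ x → IsFixed (base x) f u) (end≡g p q) p)
        in cong₂ (merge h) u₊≡u
             (trans (cong y₊ u₊≡u) (proj₂ (proj₂ (fibre-uniqueFixed u e)) q))

      unique : ∀ {z} → IsFixed σ (merge h f e) z → merge h (u₊ g) (y₊ (u₊ g)) ≡ z
      unique {z} fixed′ =
        let u , y , z≡ = unmerge h z
        in trans (unique-merge u y (subst (IsFixed σ (merge h f e)) z≡ fixed′)) (sym z≡)

    σ-uniqueFixed : UniqueFixed σ
    σ-uniqueFixed face =
      let f , e , face≡ = unmerge h face
      in subst (λ face → ∃! _≡_ (IsFixed σ face)) (sym face≡) (merge-uniqueFixed f e)

-- Replacing an edge by a USO.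

encode-injective : ∀ (O O′ : Orientation k) {v w} → encode O v ≡ encode O′ w →
  v ≡ w × dir O v ≡ dir O′ w
encode-injective O O′ = zipWith-injective _ _ _ _
  where
  zipWith-injective : ∀ {k} (v v′ w w′ : Vertex k) → zipWith combine v v′ ≡ zipWith combine w w′ →
    v ≡ w × v′ ≡ w′
  zipWith-injective []      []        []      []        _  = refl , refl
  zipWith-injective (x ∷ v) (x′ ∷ v′) (y ∷ w) (y′ ∷ w′) eq
    with refl , refl ← combine-injective x x′ y y′ (∷-injectiveˡ eq)
    with refl , refl ← zipWith-injective v v′ w w′ (∷-injectiveʳ eq) = refl , refl

-- Here b is the direction of the edge being replaced, and j labels its two ends.
module Replacement (R : GeneralizedRule d i a) where

  -- `combine x b` is the symbol 2x + b carried by the end `x`, so direction 0 pairs the symbols 0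
  -- and 2, and direction 1 pairs 1 and 3.
  Piece : Fin 2 → (Fin 2 → Fin i) → Fin 2 → Pred (Str d) a
  Piece b j x = S R (combine x b) (j x)

  usoOf : ∀ b j → DefinesUSO (Piece b j 0F ∪ Piece b j 1F)
  usoOf 0F j = uso₀₂ R (j 0F) (j 1F)
  usoOf 1F j = uso₁₃ R (j 0F) (j 1F)

  Piece-disjoint : ∀ b j {x y t} → t ∈ Piece b j x → t ∈ Piece b j y → x ≡ y
  Piece-disjoint b  j {0F} {0F} _ _ = refl
  Piece-disjoint b  j {1F} {1F} _ _ = refl
  Piece-disjoint 0F j {0F} {1F} p q = ⊥-elim (disjoint₀₂ R (j 0F) (j 1F) _ (p , q))
  Piece-disjoint 0F j {1F} {0F} p q = ⊥-elim (disjoint₀₂ R (j 0F) (j 1F) _ (q , p))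
  Piece-disjoint 1F j {0F} {1F} p q = ⊥-elim (disjoint₁₃ R (j 0F) (j 1F) _ (p , q))
  Piece-disjoint 1F j {1F} {0F} p q = ⊥-elim (disjoint₁₃ R (j 0F) (j 1F) _ (q , p))

  O : Fin 2 → (Fin 2 → Fin i) → Orientation d
  O b j = proj₁ (usoOf b j)

  O-uniqueFixed : ∀ b j → UniqueFixed (dir (O b j))
  O-uniqueFixed b j = uso⇒uniqueFixed (O b j) (proj₁ (proj₂ (usoOf b j)))

  locate : ∀ b j y → ∃ λ x → encode (O b j) y ∈ Piece b j x
  locate b j y with proj₂ (proj₂ (proj₂ (usoOf b j))) (y , refl)
  ... | inj₁ p = 0F , p
  ... | inj₂ p = 1F , p

  side : ∀ b → (Fin 2 → Fin i) → Vertex d → Fin 2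
  side b j y = proj₁ (locate b j y)

  -- Disjointness of the pieces makes the end found by `locate` the only possible one.
  decode : ∀ b j {x t} → t ∈ Piece b j x → ∃ λ y → t ≡ encode (O b j) y × x ≡ side b j y
  decode b j {x} t∈ with proj₁ (proj₂ (proj₂ (usoOf b j))) (either x t∈)
    where
    either : ∀ x {t} → t ∈ Piece b j x → t ∈ Piece b j 0F ∪ Piece b j 1F
    either 0F = inj₁
    either 1F = inj₂
  ... | y , refl = y , refl , Piece-disjoint b j t∈ (proj₂ (locate b j y))

  -- The string of `y` lies in the piece of its own side, so a new label at the other end does not
  -- remove it from the union. A string determines its vertex and the directions there, hence `y`
  -- keeps its directions and still is a sink of `e`.
  relabel : ∀ b j j′ {e y} → j (side b j y) ≡ j′ (side b j y) → IsFixed (dir (O b j)) e y →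
    IsFixed (dir (O b j′)) e y × side b j y ≡ side b j′ y
  relabel b j j′ {e} {y} same fixed
    with y′ , eq , x≡ ← decode b j′ (subst (λ l → encode (O b j) y ∈ S R (combine (side b j y) b) l)
                                           same (proj₂ (locate b j y)))
    with refl , dir≡ ← encode-injective (O b j) (O b j′) eq =
    trans fixed (cong (λ w → zipWith fromMaybe w e) dir≡) , x≡

  mix : (j j′ : Fin 2 → Fin i) → ∀ {x x′} → x ≢ x′ →
    Σ (Fin 2 → Fin i) λ j″ → j x ≡ j″ x × j′ x′ ≡ j″ x′
  mix j j′ {0F} {0F} x≢x′ = contradiction refl x≢x′
  mix j j′ {1F} {1F} x≢x′ = contradiction refl x≢x′
  mix j j′ {0F} {1F} _    = (λ { 0F → j 0F ; 1F → j′ 1F }) , refl , refl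
  mix j j′ {1F} {0F} _    = (λ { 0F → j′ 0F ; 1F → j 1F }) , refl , refl

  -- If the sides differ, some labelling agrees with `j` at the side of `y` and with `j′` at the
  -- side of `y′`. Under it both vertices remain sinks of `e`, now in a single USO, so they coincide
  -- and so do their sides.
  side-of-sink : ∀ {b b′} j j′ e {y y′} → b ≡ b′ →
    IsFixed (dir (O b j)) e y → IsFixed (dir (O b′ j′)) e y′ → side b j y ≡ side b′ j′ y′
  side-of-sink {b} j j′ e {y} {y′} refl fixed fixed′ with side b j y ≟ side b j′ y′
  ... | yes same = same
  ... | no  diff
    with j″ , jx , j′x′ ← mix j j′ diff
    with p , s ← relabel b j j″ jx fixed
    with p′ , s′ ← relabel b j′ j″ j′x′ fixed′
    with _ , _ , unique ← O-uniqueFixed b j″ e =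
    trans s (trans (cong (side b j″) (trans (sym (unique p)) (unique p′))) (sym s′))

-- The rewritten orientation and its encoding.

module Rewriting (R : GeneralizedRule d i a) (h : Fin (suc k)) (P : Orientation (suc k))
                 (P-uso : IsUSO P) (label : Vertex (suc k) → Fin i) where

  open Replacement R
  open Facets (dir P) (uso⇒uniqueFixed P P-uso) h

  ends : Vertex k → Fin 2 → Fin i
  ends u x = label (insertAt u h x)

  fibre : Vertex k → Orientation d
  fibre u = O (axis u) (ends u)

  end : Vertex k → Vertex d → Fin 2
  end u = side (axis u) (ends u)

  open Product h facet (dir ∘ fibre) end

  Q-uniqueFixed : UniqueFixed σ
  Q-uniqueFixed = σ-uniqueFixed facet-uniqueFixed (λ u → O-uniqueFixed (axis u) (ends u))
    -- `axis-agrees` supplies the common edge direction that `side-of-sink` requires; the labels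
    -- above `u` and `u′` may be unrelated.
    λ {f} {e} {u = u} {u′} p p′ → side-of-sink (ends u) (ends u′) e (axis-agrees f p p′)

  Q : Orientation (k + d)
  Q = orientation σ Q-uniqueFixed

  -- Outside position `h` the spliced string keeps the symbols of the end `end u y`, which is the
  -- end whose facet orientation `σ` uses at this vertex.
  splice-encode : ∀ u y → splice (encode P (insertAt u h (end u y))) h (encode (fibre u) y) ≡
                          encode Q (merge h u y)
  splice-encode u y = trans
    (splice-zipWith combine u h (end u y) (dir P (insertAt u h (end u y))) y (dir (fibre u) y))
    (cong (zipWith combine (merge h u y)) (sym (σ-merge u y)))

  lookup-encode : ∀ u x → lookup (encode P (insertAt u h x)) h ≡ combine x (axis u)
  lookup-encode u x = trans (lookup-zipWith combine h (insertAt u h x) _)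
                            (cong₂ combine (insertAt-lookup u h x) (axis-const u x))

  -- `T` indexed by the vertices of `P` instead of the strings of `K`, so that no membership proofs
  -- occur.
  Image : Pred (Str (k + d)) _
  Image s = ∃ λ w → ∃ λ t → t ∈ S R (lookup (encode P w) h) (label w) × s ≡ splice (encode P w) h t

  Image⊆Q : ∀ {s} → s ∈ Image → s ∈ Encoding Q
  Image⊆Q (w , t , t∈ , refl) =
    subst (λ w → t ∈ S R (lookup (encode P w) h) (label w) → splice (encode P w) h t ∈ Encoding Q)
      (insertAt-removeAt w h) (onInsert (removeAt w h) (lookup w h)) t∈
    where
    onInsert : ∀ u x → t ∈ S R (lookup (encode P (insertAt u h x)) h) (ends u x) →
      splice (encode P (insertAt u h x)) h t ∈ Encoding Q
    onInsert u x t∈ =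
      let y , t≡ , x≡ = decode (axis u) (ends u) (subst (λ c → t ∈ S R c (ends u x)) (lookup-encode u x) t∈)
      in merge h u y ,
         trans (cong₂ (λ x t → splice (encode P (insertAt u h x)) h t) x≡ t≡) (splice-encode u y)

  Q⊆Image : ∀ {s} → s ∈ Encoding Q → s ∈ Image
  Q⊆Image (z , refl) =
    let u , y , z≡ = unmerge h z
    in subst (λ z → encode Q z ∈ Image) (sym z≡)
         ( insertAt u h (end u y) , encode (fibre u) y
         , subst (λ c → encode (fibre u) y ∈ S R c (ends u (end u y)))
                 (sym (lookup-encode u (end u y))) (proj₂ (locate (axis u) (ends u) y))
         , sym (splice-encode u y) )

lemma22 : {a ℓ : Level} (k d i : ℕ) → 1 ≤ k → 1 ≤ i →
    (R : GeneralizedRule d i a) (h : Fin k) (K : Pred (Str k) ℓ) →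
    DefinesUSO K → (L : Labelling K i) → DefinesUSO (T R h K L)
lemma22 (suc k) d i _ _ R h K (P , P-uso , K⊆P , P⊆K) L =
  Q , orientation-uso _ Q-uniqueFixed , T⊆Q , Q⊆T
  where
  open Rewriting R h P P-uso (λ w → L (encode P w) (P⊆K (w , refl)))

  T⊆Q : ∀ {s} → s ∈ T R h K L → s ∈ Encoding Q
  -- The labels computed from `v∈K` and from `P⊆K` agree definitionally, as the membership argument
  -- of `L` is irrelevant.
  T⊆Q (v , v∈K , t , t∈ , s≡) with w , refl ← K⊆P v∈K = Image⊆Q (w , t , t∈ , s≡)

  Q⊆T : ∀ {s} → s ∈ Encoding Q → s ∈ T R h K L
  Q⊆T s∈ = let w , t , t∈ , s≡ = Q⊆Image s∈ in encode P w , P⊆K (w , refl) , t , t∈ , s≡
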